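{- For any (probabilistic bounded error or deterministic) symbolic algorithm that solves $\mathrm{Safe}(T)$, and likewise for any that solves $\text{coBüchi}(T)$, the following lower bounds on the required number of symbolic one-step operations hold: (1) $\Omega(n)$ even for constant diameter graphs; (2) $\Omega(|T|)$ even for constant diameter graphs; and (3) $\omega\big(\sum_{C\in SCCs(G)}(D_C+1)\big)$ even for constant diameter graphs.
   Context: Symbolic model: the input is a finite directed graph $G=(V,E)$ (self-loops allowed), $n=|V|$, together with a starting vertex $s\in V$ and a set $T\subseteq V$ of safe vertices. The algorithm knows $V$, $s$, $T$, but it can access $E$ only through the one-step operations $\mathrm{Pre}(S)=\{v\in V\mid \exists s'\in S:(v,s')\in E\}$ and $\mathrm{Post}(S)=\{v\in V\mid \exists s'\in S:(s',v)\in E\}$ applied to (adaptively chosen) sets $S\subseteq V$. All other computation, in particular basic set operations on vertex sets, is unrestricted and not counted in lower bounds; any number of sets may be stored. A probabilistic bounded error algorithm may use random bits and must be correct with probability at least $2/3$ on every (admissible) input. $\mathrm{Safe}(T)$: decide whether there is an infinite path in $G$ starting from $s$ that only visits vertices of $T$. $\text{coBüchi}(T)$ (co-liveness): decide whether there is an infinite path in $G$ starting from $s$ that eventually only visits vertices of $T$. Convention for lower bounds: a lower bound $\Omega(g)$, for a parameter $g$ of the input, means: there is an absolute constant $c>0$ such that every (deterministic or probabilistic bounded error) symbolic algorithm solving the problem performs, on inputs with arbitrarily large $g$, at least $c\cdot g$ one-step operations (worst case over its random choices). A lower bound $\omega(g)$ means: for every constant $K>0$ and every such algorithm there is an input on which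 it performs more than $K\cdot g$ one-step operations (worst case over its random choices), i.e. no algorithm uses $O(g)$ one-step operations. "Even for constant diameter graphs" means that, for some fixed constant $d_0$, this already holds when the algorithm need only be correct on graphs of diameter at most $d_0$, the hard inputs having diameter at most $d_0$. The diameter of $G$ is the largest finite distance: the maximum of $d(u,v)$ over all pairs $u,v$ such that $u$ can reach $v$, where $d(u,v)$ is the smallest number of edges on a path from $u$ to $v$. $SCCs(G)$ is the set of strongly connected components of $G$, and $D_C$ is the diameter of (the subgraph induced by) the component $C$. -}

module Defs where

open import Data.Bool using (Bool; true; false; if_then_else_)
open import Data.Bool.Properties using () renaming (_≟_ to _≟ᵇ_)
open import Data.Fin using (Fin)
open import Data.Fin.Properties using (any?)
open import Data.Fin.Subset using (Subset; _∈_)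
open import Data.Fin.Subset.Properties using (_∈?_)
open import Data.Integer using (+_)
open import Data.List using (List; []; _∷_; map; sum)
open import Data.List.Membership.Propositional using () renaming (_∈_ to _∈ˡ_)
open import Data.List.Relation.Binary.Pointwise using (Pointwise)
open import Data.List.Relation.Unary.Unique.Propositional using (Unique)
open import Data.Nat using (ℕ; zero; suc; _≤_)
open import Data.Product using (Σ; ∃; ∃₂; _×_; _,_; proj₁)
open import Data.Rational using (ℚ; 0ℚ; 1ℚ; ½; _/_)
  renaming (_+_ to _+ℚ_; _*_ to _*ℚ_; _≤_ to _≤ℚ_; _<_ to _<ℚ_)
open import Data.Sum using (_⊎_; inj₁; inj₂)
open import Data.Vec using (tabulate)
open import Function using (_⇔_; _on_)
open import Level using (0ℓ)
open import Relation.Binary using (Rel)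
open import Relation.Binary.Construct.Closure.ReflexiveTransitive using (Star; ε; _◅_)
open import Relation.Binary.PropositionalEquality using (_≡_)
open import Relation.Nullary using (¬_; does)
open import Relation.Nullary.Decidable using (_×-dec_)

------------------------------------------------------------------------
-- Graphs

Digraph : ℕ → Set
Digraph n = Fin n → Fin n → Bool

Edge : ∀ {n} → Digraph n → Rel (Fin n) 0ℓ
Edge G u v = G u v ≡ true

Pre : ∀ {n} → Digraph n → Subset n → Subset n
Pre G S = tabulate λ v → does (any? λ s′ → (s′ ∈? S) ×-dec (G v s′ ≟ᵇ true))

Post : ∀ {n} → Digraph n → Subset n → Subset n
Post G S = tabulate λ v → does (any? λ s′ → (s′ ∈? S) ×-dec (G s′ v ≟ᵇ true))

-- Distances and diameters are defined for an arbitrary edge relation, so that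
-- they apply both to a graph and to its induced subgraphs.

length : ∀ {V : Set} {R : Rel V 0ℓ} {u v : V} → Star R u v → ℕ
length ε       = 0
length (_ ◅ p) = suc (length p)

IsDistance : {V : Set} → Rel V 0ℓ → V → V → ℕ → Set
IsDistance R u v d =
  (Σ (Star R u v) λ p → length p ≡ d) × ((p : Star R u v) → d ≤ length p)

-- Pairs with v unreachable from u have no distance and so do not contribute.
IsDiameter : {V : Set} → Rel V 0ℓ → ℕ → Set
IsDiameter R D =
  (∃₂ λ u v → IsDistance R u v D) × (∀ u v d → IsDistance R u v d → d ≤ D)

IsSCC : ∀ {n} → Digraph n → Subset n → Set
IsSCC G C = ∃ λ u → ∀ v → v ∈ C ⇔ (Star (Edge G) u v × Star (Edge G) v u)

Induced : ∀ {n} → Digraph n → (C : Subset n) → Rel (Σ (Fin n) (_∈ C)) 0ℓ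
Induced G C = Edge G on proj₁

-- m = Σ_{C ∈ SCCs(G)} (D_C + 1): Cs lists every component exactly once and
-- Ds lists the corresponding diameters.
IsSCCDiameterSum : ∀ {n} → Digraph n → ℕ → Set
IsSCCDiameterSum {n} G m =
  ∃₂ λ (Cs : List (Subset n)) (Ds : List ℕ) →
    Unique Cs
    × (∀ C → C ∈ˡ Cs ⇔ IsSCC G C)
    × Pointwise (λ C D → IsDiameter (Induced G C) D) Cs Ds
    × m ≡ sum (map suc Ds)

------------------------------------------------------------------------
-- Inputs and objectives

record Input : Set where
  field
    n     : ℕ
    graph : Digraph n
    start : Fin n
    safe  : Subset n

open Input public

DiameterAtMost : ℕ → Input → Set
DiameterAtMost d₀ I = ∃ λ D → IsDiameter (Edge (graph I)) D × D ≤ d₀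

IsInfinitePath : (I : Input) → (ℕ → Fin (n I)) → Set
IsInfinitePath I p = p 0 ≡ start I × (∀ i → Edge (graph I) (p i) (p (suc i)))

Problem : Set₁
Problem = Input → Set

Safe : Problem
Safe I = ∃ λ p → IsInfinitePath I p × (∀ i → p i ∈ safe I)

CoBüchi : Problem
CoBüchi I = ∃ λ p → IsInfinitePath I p × (∃ λ k → ∀ i → k ≤ i → p i ∈ safe I)

------------------------------------------------------------------------
-- Symbolic algorithms

data Action (n : ℕ) : Set where
  pre post : Subset n → Action n
  coin     : Action n
  halt     : Bool → Action n

-- The answers received so far, most recent first: sets returned by one-step
-- operations and outcomes of fair coin tosses.
History : ℕ → Set
History n = List (Subset n ⊎ Bool)

-- Since the next action is an arbitrary function of everything learnt so far,
-- storage and all computation other than one-step operations are unrestricted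
-- and free.  Termination is not required.
Strategy : ℕ → Set
Strategy n = History n → Action n

-- An algorithm knows V = Fin n, the start vertex and the safe set, but not the
-- edges.  The deterministic algorithms are those that never play coin; their
-- answer probabilities are 0 or 1.
Algorithm : Set
Algorithm = ∀ n → Fin n → Subset n → Strategy n

-- Probability that, continuing from history h, the strategy halts with answer
-- b at the latest at its t-th action.
haltProb : ∀ {n} → Strategy n → Digraph n → Bool → ℕ → History n → ℚ
haltProb σ G b zero    h = 0ℚ
haltProb σ G b (suc t) h with σ h
... | pre S  = haltProb σ G b t (inj₁ (Pre G S) ∷ h)
... | post S = haltProb σ G b t (inj₁ (Post G S) ∷ h)
... | coin   = ½ *ℚ haltProb σ G b t (inj₂ true ∷ h)
               +ℚ ½ *ℚ haltProb σ G b t (inj₂ false ∷ h)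
... | halt a = if does (a ≟ᵇ b) then 1ℚ else 0ℚ

-- The probability of eventually answering b is the supremum over t of the
-- (nondecreasing) haltProb … t [], here required to be at least 2/3.
AnswersWHP : Algorithm → Input → Bool → Set
AnswersWHP A I b =
  ∀ q → q <ℚ (+ 2 / 3) →
  ∃ λ t → q ≤ℚ haltProb (A (n I) (start I) (safe I)) (graph I) b t []

Correct : Problem → Algorithm → Input → Set
Correct P A I = (P I → AnswersWHP A I true) × (¬ P I → AnswersWHP A I false)

-- For some outcomes of its coin tosses, the strategy, continuing from history
-- h, performs at least k one-step operations.
data PerformsFrom {n} (σ : Strategy n) (G : Digraph n) : History n → ℕ → Set where
  stop     : ∀ {h} → PerformsFrom σ G h 0
  by-pre   : ∀ {h k S} → σ h ≡ pre S →
             PerformsFrom σ G (inj₁ (Pre G S) ∷ h) k → PerformsFrom σ G h (suc k)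
  by-post  : ∀ {h k S} → σ h ≡ post S →
             PerformsFrom σ G (inj₁ (Post G S) ∷ h) k → PerformsFrom σ G h (suc k)
  by-coin  : ∀ {h k} → σ h ≡ coin → (b : Bool) →
             PerformsFrom σ G (inj₂ b ∷ h) k → PerformsFrom σ G h k

Performs : Algorithm → Input → ℕ → Set
Performs A I k = PerformsFrom (A (n I) (start I) (safe I)) (graph I) [] k

------------------------------------------------------------------------
-- Lower bounds that hold even for constant diameter graphs

fromℕ : ℕ → ℚ
fromℕ m = + m / 1

SolvesUpToDiameter : ℕ → Problem → Algorithm → Set
SolvesUpToDiameter d₀ P A = ∀ I → DiameterAtMost d₀ I → Correct P A I

Ω-ConstDiameter : Problem → (Input → ℕ) → Set
Ω-ConstDiameter P g =
  ∃₂ λ (d₀ : ℕ) (c : ℚ) → 0ℚ <ℚ c ×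
    (∀ A → SolvesUpToDiameter d₀ P A →
     ∀ N → ∃₂ λ I k →
       DiameterAtMost d₀ I × N ≤ g I × Performs A I k × c *ℚ fromℕ (g I) ≤ℚ fromℕ k)

-- The parameter is given by its graph: g I m says that its value on I is m.
ω-ConstDiameter : Problem → (Input → ℕ → Set) → Set
ω-ConstDiameter P g =
  ∃ λ (d₀ : ℕ) →
    ∀ (K : ℚ) → 0ℚ <ℚ K →
    ∀ A → SolvesUpToDiameter d₀ P A →
    ∃ λ I → ∃₂ λ m k →
      DiameterAtMost d₀ I × g I m × Performs A I k × K *ℚ fromℕ m <ℚ fromℕ k

{-# OPTIONS --safe #-}
module Submission where

-- The hard graphs consist of a hub outside T, joined to every vertex in both
-- directions, and a transitive tournament on T starting at s; they have
-- diameter at most 2 and a single strongly connected component.  Inside T the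
-- tournament has no infinite path, but with one additional self-loop it does.
-- Pre(S) can reveal a loop at u only if u is the last vertex of S in the
-- tournament, and Post(S) only if u is the first one, so each one-step
-- operation tests at most one candidate u.  Run the algorithm on the graph
-- without additional loops: for each u, the expected number of operations
-- testing u bounds the change in the probability of answering true caused by
-- the loop at u, which must be at least a positive constant.  Summed over u,
-- these expectations are at most the worst-case number of operations, which is
-- thus linear in |T|.

open import Defs
open import Algebra.Properties.CommutativeMonoid.Sum
  using (sum; ∑-distrib-+; sum-cong-≗; sum-replicate-zero)
open import Data.Bool using (Bool; true; false; if_then_else_; _∨_; _∧_)
open import Data.Bool.Properties using (∨-zeroʳ) renaming (_≟_ to _≟ᵇ_)
open import Data.Empty using (⊥)
open import Data.Fin as Fin using (Fin; zero; suc; toℕ)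
import Data.Fin.Properties as Finₚ
open import Data.Fin.Subset using (Subset; _∈_; ∣_∣; ⊤; outside)
open import Data.Fin.Subset.Properties using (_∈?_; ∈⊤; ⊆⊤; ⊆-antisym; ∣⊤∣≡n)
open import Data.Integer as ℤ using (+_; -[1+_])
import Data.Integer.Properties as ℤₚ
open import Data.List using ([]; _∷_)
open import Data.List.Membership.Propositional using () renaming (_∈_ to _∈ˡ_)
open import Data.List.Relation.Binary.Pointwise using ([]; _∷_)
open import Data.List.Relation.Unary.All using ([])
open import Data.List.Relation.Unary.AllPairs using ([]; _∷_)
open import Data.List.Relation.Unary.Any using (here)
open import Data.Nat as ℕ using (ℕ; zero; suc; z≤n; s≤s)
import Data.Nat.Coprimality as Coprimality
import Data.Nat.Properties as ℕₚ
open import Data.Product using (∃; _×_; _,_; proj₁; proj₂)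
open import Data.Rational
  using (ℚ; mkℚ; 0ℚ; 1ℚ; ½; _/_; -_; _+_; _*_; _≤_; _<_; *≤*; *<*)
open import Data.Rational.Properties hiding (_≟_)
open import Data.Rational.Solver using (module +-*-Solver)
open import Data.Sum using (_⊎_; inj₁; inj₂; [_,_]′; swap)
open import Data.Vec using (_∷_; there)
import Data.Vec.Properties as Vecₚ
open import Function using (_∘_; mk⇔; flip; Equivalence)
open import Level using (0ℓ)
open import Relation.Binary using (Rel; DecidableEquality; tri<; tri≈; tri>)
open import Relation.Binary.Construct.Closure.ReflexiveTransitive using (Star; ε; _◅_)
open import Relation.Binary.PropositionalEquality
  using (_≡_; _≢_; refl; sym; trans; cong; cong₂; subst; module ≡-Reasoning)
open import Relation.Nullary using (¬_; Dec; yes; no; does; proof; contradiction)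
open import Relation.Nullary.Decidable using (¬?; dec-true; does-⇔; from-yes)
open import Relation.Nullary.Reflects using (Reflects; invert)

-- Finite sums and rational arithmetic

∑ : ∀ {m} → (Fin m → ℚ) → ℚ
∑ = sum +-0-commutativeMonoid

𝟙 : ∀ {A : Set} → Dec A → ℚ
𝟙 a? = if does a? then 1ℚ else 0ℚ

0≤1 : 0ℚ ≤ 1ℚ
0≤1 = from-yes (0ℚ ≤? 1ℚ)

𝟙-nonneg : ∀ {A : Set} (a? : Dec A) → 0ℚ ≤ 𝟙 a?
𝟙-nonneg (yes _) = 0≤1
𝟙-nonneg (no _)  = ≤-refl

∑-mono : ∀ {m} {f g : Fin m → ℚ} → (∀ i → f i ≤ g i) → ∑ f ≤ ∑ g
∑-mono {zero}  f≤g = ≤-refl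
∑-mono {suc m} f≤g = +-mono-≤ (f≤g zero) (∑-mono (f≤g ∘ suc))

∑-zero : ∀ {m} {f : Fin m → ℚ} → (∀ i → f i ≡ 0ℚ) → ∑ f ≡ 0ℚ
∑-zero {m} f≡0 =
  trans (sum-cong-≗ +-0-commutativeMonoid f≡0) (sum-replicate-zero +-0-commutativeMonoid m)

∑-𝟙≤1 : ∀ {m} {P : Fin m → Set} (P? : ∀ i → Dec (P i)) →
        (∀ {i j} → P i → P j → i ≡ j) → ∑ (λ i → 𝟙 (P? i)) ≤ 1ℚ
∑-𝟙≤1 {zero}  P? unique = 0≤1
∑-𝟙≤1 {suc m} {P} P? unique with P? zero
... | yes p = ≤-reflexive (cong (λ s → 1ℚ + s) (∑-zero others))
  where
  others : ∀ i → 𝟙 (P? (suc i)) ≡ 0ℚ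
  others i with P? (suc i)
  ... | yes q = contradiction (unique p q) λ ()
  ... | no _  = refl
... | no _ = ≤-trans (≤-reflexive (+-identityˡ _))
                     (∑-𝟙≤1 (P? ∘ suc) (λ p q → Finₚ.suc-injective (unique p q)))

avg : ℚ → ℚ → ℚ
avg a b = ½ * a + ½ * b

avg-mono : ∀ {a b c d} → a ≤ b → c ≤ d → avg a c ≤ avg b d
avg-mono a≤b c≤d = +-mono-≤ (*-monoˡ-≤-nonNeg ½ a≤b) (*-monoˡ-≤-nonNeg ½ c≤d)

avg-idem : ∀ a → avg a a ≡ a
avg-idem = solve 1 (λ a → con ½ :* a :+ con ½ :* a := a) refl
  where open +-*-Solver

avg-+ : ∀ a b c d → avg (a + b) (c + d) ≡ avg a c + avg b d
avg-+ = solve 4 (λ a b c d → con ½ :* (a :+ b) :+ con ½ :* (c :+ d)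
  := (con ½ :* a :+ con ½ :* c) :+ (con ½ :* b :+ con ½ :* d)) refl
  where open +-*-Solver

∑-avg : ∀ {m} (f g : Fin m → ℚ) → ∑ (λ i → avg (f i) (g i)) ≡ avg (∑ f) (∑ g)
∑-avg {zero}  f g = refl
∑-avg {suc m} f g =
  trans (cong (λ s → avg (f zero) (g zero) + s) (∑-avg (f ∘ suc) (g ∘ suc)))
        (sym (avg-+ (f zero) (∑ (f ∘ suc)) (g zero) (∑ (g ∘ suc))))

1-coprime : ∀ m → Coprimality.Coprime m 1
1-coprime m = Coprimality.sym (Coprimality.1-coprimeTo m)

-- `+ m / 1` is normalised by a gcd that is stuck for a variable `m`; the explicit form exposes
-- numerator and denominator to computation.
fromℕ-mkℚ : ∀ m → fromℕ m ≡ mkℚ (+ m) 0 (1-coprime m)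
fromℕ-mkℚ m = normalize-coprime (1-coprime m)

fromℕ-+ : ∀ a b → fromℕ (a ℕ.+ b) ≡ fromℕ a + fromℕ b
fromℕ-+ a b = begin
  fromℕ (a ℕ.+ b)
    ≡⟨ cong₂ (λ x y → (x ℤ.+ y) / 1) (ℤₚ.*-identityʳ (+ a)) (ℤₚ.*-identityʳ (+ b)) ⟨
  mkℚ (+ a) 0 (1-coprime a) + mkℚ (+ b) 0 (1-coprime b)
    ≡⟨ cong₂ _+_ (fromℕ-mkℚ a) (fromℕ-mkℚ b) ⟨
  fromℕ a + fromℕ b ∎
  where open ≡-Reasoning

fromℕ-mono : ∀ a b → a ℕ.≤ b → fromℕ a ≤ fromℕ b
fromℕ-mono a b a≤b rewrite fromℕ-mkℚ a | fromℕ-mkℚ b =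
  *≤* (ℤₚ.*-monoʳ-≤-nonNeg (+ 1) (ℤ.+≤+ a≤b))

archimedean : ∀ q → ∃ λ m → q < fromℕ m
archimedean (mkℚ (+ p) d c) = suc p ,
  subst (mkℚ (+ p) d c <_) (sym (fromℕ-mkℚ (suc p)))
    (*<* (subst (ℤ._< + (suc p ℕ.* suc d)) (sym (ℤₚ.*-identityʳ (+ p)))
      (ℤ.+<+ (ℕₚ.m≤m*n (suc p) (suc d)))))
archimedean (mkℚ -[1+ p ] d c) = 0 , *<* ℤ.-<+

∑-const : ∀ m c → ∑ {m} (λ _ → c) ≡ fromℕ m * c
∑-const zero    c = sym (*-zeroˡ c)
∑-const (suc m) c = begin
  c + ∑ {m} (λ _ → c)  ≡⟨ cong₂ _+_ (sym (*-identityˡ c)) (∑-const m c) ⟩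
  1ℚ * c + fromℕ m * c ≡⟨ *-distribʳ-+ c 1ℚ (fromℕ m) ⟨
  (1ℚ + fromℕ m) * c   ≡⟨ cong (_* c) (fromℕ-+ 1 m) ⟨
  fromℕ (suc m) * c    ∎
  where open ≡-Reasoning

-- Passes from candidate loops to vertices: `y` will be the number of tournament vertices and `x`
-- that of all vertices; the factor lost in `x ≤ y + y` halves the constant 1/6.
rescale : ∀ x y z → x ≤ y + y → y * (+ 1 / 6) ≤ z → (+ 1 / 12) * x ≤ z
rescale x y z x≤2y y/6≤z = begin
  (+ 1 / 12) * x       ≤⟨ *-monoˡ-≤-nonNeg (+ 1 / 12) x≤2y ⟩
  (+ 1 / 12) * (y + y) ≡⟨ solve 1 (λ y → con (+ 1 / 12) :* (y :+ y) := y :* con (+ 1 / 6)) refl y ⟩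
  y * (+ 1 / 6)        ≤⟨ y/6≤z ⟩
  z                    ∎
  where
  open ≤-Reasoning
  open +-*-Solver

scale-mono : ∀ a b k → a ℕ.≤ b → (+ 1 / 12) * fromℕ b ≤ fromℕ k → (+ 1 / 12) * fromℕ a ≤ fromℕ k
scale-mono a b k a≤b = ≤-trans (*-monoˡ-≤-nonNeg (+ 1 / 12) (fromℕ-mono a b a≤b))

scale-< : ∀ x y z → fromℕ 36 * x < y → (+ 1 / 12) * y ≤ z → x * fromℕ 3 < z
scale-< x y z 36x<y y/12≤z = begin-strict
  x * fromℕ 3
    ≡⟨ solve 1 (λ x → x :* con (fromℕ 3) := con (+ 1 / 12) :* (con (fromℕ 36) :* x)) refl x ⟩
  (+ 1 / 12) * (fromℕ 36 * x)
    <⟨ *-monoʳ-<-pos (+ 1 / 12) 36x<y ⟩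
  (+ 1 / 12) * y
    ≤⟨ y/12≤z ⟩
  z ∎
  where
  open ≤-Reasoning
  open +-*-Solver

∑-suc : ∀ {m} {f g : Fin m → ℚ} k → ∑ f ≤ 1ℚ → ∑ g ≤ fromℕ k →
        ∑ (λ i → f i + g i) ≤ fromℕ (suc k)
∑-suc {f = f} {g} k ∑f≤1 ∑g≤k = begin
  ∑ (λ i → f i + g i) ≡⟨ ∑-distrib-+ +-0-commutativeMonoid f g ⟩
  ∑ f + ∑ g           ≤⟨ +-mono-≤ ∑f≤1 ∑g≤k ⟩
  1ℚ + fromℕ k        ≡⟨ fromℕ-+ 1 k ⟨
  fromℕ (suc k)       ∎
  where open ≤-Reasoning

∑-avg≤ : ∀ {m} {f g : Fin m → ℚ} k → ∑ f ≤ fromℕ k → ∑ g ≤ fromℕ k →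
         ∑ (λ i → avg (f i) (g i)) ≤ fromℕ k
∑-avg≤ {f = f} {g} k f≤k g≤k = begin
  ∑ (λ i → avg (f i) (g i)) ≡⟨ ∑-avg f g ⟩
  avg (∑ f) (∑ g)           ≤⟨ avg-mono f≤k g≤k ⟩
  avg (fromℕ k) (fromℕ k)   ≡⟨ avg-idem (fromℕ k) ⟩
  fromℕ k                   ∎
  where open ≤-Reasoning

bounded : ∀ {m} (f : Fin m → ℕ) → ∃ λ t → ∀ i → f i ℕ.≤ t
bounded {zero}  f = 0 , λ ()
bounded {suc m} f with bounded (f ∘ suc)
... | t , f≤t = f zero ℕ.⊔ t , λ where
  zero    → ℕₚ.m≤m⊔n (f zero) t
  (suc i) → ℕₚ.≤-trans (f≤t i) (ℕₚ.m≤n⊔m (f zero) t)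

_≟ˢ_ : ∀ {n} → DecidableEquality (Subset n)
_≟ˢ_ = Vecₚ.≡-dec _≟ᵇ_

-- One query in a comparison of two runs: `X` is its answer on the reference graph, `Y` on the
-- perturbed one. Equal answers leave the induction hypothesis intact; different ones make the
-- indicator 1, which already dominates any probability.
answer-perturb : ∀ {n} (p : Subset n → ℚ) {X Y r s} → p X ≤ r + s → p Y ≤ 1ℚ →
                 0ℚ ≤ r → 0ℚ ≤ s → p Y ≤ r + (𝟙 (¬? (X ≟ˢ Y)) + s)
answer-perturb p {X} {Y} {r} {s} pX≤ pY≤1 0≤r 0≤s with X ≟ˢ Y
... | yes refl = ≤-trans pX≤ (≤-reflexive (cong (λ x → r + x) (sym (+-identityˡ s))))
... | no _     = ≤-trans pY≤1 (+-mono-≤ 0≤r (+-monoʳ-≤ 1ℚ 0≤s))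

-- Halting probabilities on perturbed graphs

module _ {n} (σ : Strategy n) where

  haltProb-nonneg : ∀ G b t h → 0ℚ ≤ haltProb σ G b t h
  haltProb-nonneg G b zero    h = ≤-refl
  haltProb-nonneg G b (suc t) h with σ h
  ... | pre S  = haltProb-nonneg G b t _
  ... | post S = haltProb-nonneg G b t _
  ... | coin   = avg-mono (haltProb-nonneg G b t _) (haltProb-nonneg G b t _)
  ... | halt a = 𝟙-nonneg (a ≟ᵇ b)

  haltProb-mono : ∀ G b {t t′} h → t ℕ.≤ t′ → haltProb σ G b t h ≤ haltProb σ G b t′ h
  haltProb-mono G b {t′ = t′} h z≤n = haltProb-nonneg G b t′ h
  haltProb-mono G b h (s≤s t≤t′) with σ h
  ... | pre S  = haltProb-mono G b _ t≤t′
  ... | post S = haltProb-mono G b _ t≤t′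
  ... | coin   = avg-mono (haltProb-mono G b _ t≤t′) (haltProb-mono G b _ t≤t′)
  ... | halt a = ≤-refl

  haltProb-total≤1 : ∀ G t h → haltProb σ G true t h + haltProb σ G false t h ≤ 1ℚ
  haltProb-total≤1 G zero    h = 0≤1
  haltProb-total≤1 G (suc t) h with σ h
  ... | pre S      = haltProb-total≤1 G t _
  ... | post S     = haltProb-total≤1 G t _
  ... | coin       = ≤-trans
    (≤-reflexive (sym (avg-+ (p true true) (p false true) (p true false) (p false false))))
    (avg-mono (haltProb-total≤1 G t _) (haltProb-total≤1 G t _))
    where
    p : Bool → Bool → ℚ
    p b c = haltProb σ G b t (inj₂ c ∷ h)
  ... | halt true  = ≤-refl
  ... | halt false = ≤-refl

  haltTrue≤1 : ∀ G t h → haltProb σ G true t h ≤ 1ℚ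
  haltTrue≤1 G t h = begin
    p                          ≡⟨ +-identityʳ p ⟨
    p + 0ℚ                     ≤⟨ +-monoʳ-≤ p (haltProb-nonneg G false t h) ⟩
    p + haltProb σ G false t h ≤⟨ haltProb-total≤1 G t h ⟩
    1ℚ                         ∎
    where
    open ≤-Reasoning
    p = haltProb σ G true t h

  -- Expected number of one-step operations, among the first t actions of the
  -- run on G, whose answer would have been different on H.
  hits : Digraph n → Digraph n → ℕ → History n → ℚ
  hits G H zero    h = 0ℚ
  hits G H (suc t) h with σ h
  ... | pre S  = 𝟙 (¬? (Pre G S ≟ˢ Pre H S)) + hits G H t (inj₁ (Pre G S) ∷ h)
  ... | post S = 𝟙 (¬? (Post G S ≟ˢ Post H S)) + hits G H t (inj₁ (Post G S) ∷ h)
  ... | coin   = avg (hits G H t (inj₂ true ∷ h)) (hits G H t (inj₂ false ∷ h))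
  ... | halt _ = 0ℚ

  hits-nonneg : ∀ G H t h → 0ℚ ≤ hits G H t h
  hits-nonneg G H zero    h = ≤-refl
  hits-nonneg G H (suc t) h with σ h
  ... | pre S  = +-mono-≤ (𝟙-nonneg (¬? (Pre G S ≟ˢ Pre H S))) (hits-nonneg G H t _)
  ... | post S = +-mono-≤ (𝟙-nonneg (¬? (Post G S ≟ˢ Post H S))) (hits-nonneg G H t _)
  ... | coin   = avg-mono (hits-nonneg G H t _) (hits-nonneg G H t _)
  ... | halt _ = ≤-refl

  -- Run `σ` on both graphs with the same coins. The histories agree up to the first operation whose
  -- answers differ, so the probability of answering `true` rises by at most the probability that
  -- such an operation occurs, and hence by at most the expected number of such operations.
  haltTrue-perturb : ∀ G H t h → haltProb σ H true t h ≤ haltProb σ G true t h + hits G H t h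
  haltTrue-perturb G H zero    h = ≤-refl
  haltTrue-perturb G H (suc t) h with σ h
  ... | pre S  = answer-perturb (λ X → haltProb σ H true t (inj₁ X ∷ h))
                   (haltTrue-perturb G H t _) (haltTrue≤1 H t _)
                   (haltProb-nonneg G true t _) (hits-nonneg G H t _)
  ... | post S = answer-perturb (λ X → haltProb σ H true t (inj₁ X ∷ h))
                   (haltTrue-perturb G H t _) (haltTrue≤1 H t _)
                   (haltProb-nonneg G true t _) (hits-nonneg G H t _)
  ... | coin   = ≤-trans (avg-mono (haltTrue-perturb G H t _) (haltTrue-perturb G H t _))
                         (≤-reflexive (avg-+ (p true) (x true) (p false) (x false)))
    where
    p x : Bool → ℚ
    p c = haltProb σ G true t (inj₂ c ∷ h)
    x c = hits G H t (inj₂ c ∷ h)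
  ... | halt a = ≤-reflexive (sym (+-identityʳ _))

-- Counting operations over a family of perturbed graphs

record SeparatesOne {n m} (G : Digraph n) (H : Fin m → Digraph n) : Set where
  field
    by-Pre  : ∀ S {i j} → Pre G S ≢ Pre (H i) S → Pre G S ≢ Pre (H j) S → i ≡ j
    by-Post : ∀ S {i j} → Post G S ≢ Post (H i) S → Post G S ≢ Post (H j) S → i ≡ j

module _ {n m} (σ : Strategy n) {G : Digraph n} {H : Fin m → Digraph n}
         (separatesOne : SeparatesOne G H) where
  open SeparatesOne separatesOne

  -- By `SeparatesOne`, each operation adds at most 1 to the sum of `hits` over the whole family. A
  -- coin toss averages two such sums, so the larger of the two operation counts bounds the average;
  -- following that branch yields a single run as witness.
  ∑-hits≤performed : ∀ t h → ∃ λ k → PerformsFrom σ G h k × ∑ (λ i → hits σ G (H i) t h) ≤ fromℕ k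
  ∑-hits≤performed zero    h = 0 , stop , ≤-reflexive (∑-zero {m} λ _ → refl)
  ∑-hits≤performed (suc t) h with σ h in eq
  ... | pre S =
    let k , performs , ∑≤k = ∑-hits≤performed t (inj₁ (Pre G S) ∷ h)
    in suc k , by-pre eq performs ,
       ∑-suc {m} k (∑-𝟙≤1 (λ i → ¬? (Pre G S ≟ˢ Pre (H i) S)) (by-Pre S)) ∑≤k
  ... | post S =
    let k , performs , ∑≤k = ∑-hits≤performed t (inj₁ (Post G S) ∷ h)
    in suc k , by-post eq performs ,
       ∑-suc {m} k (∑-𝟙≤1 (λ i → ¬? (Post G S ≟ˢ Post (H i) S)) (by-Post S)) ∑≤k
  ... | halt _ = 0 , stop , ≤-reflexive (∑-zero {m} λ _ → refl)
  ... | coin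
    with ∑-hits≤performed t (inj₂ true ∷ h) | ∑-hits≤performed t (inj₂ false ∷ h)
  ...   | k , performs , ∑≤k | l , performs′ , ∑≤l with ℕₚ.≤-total k l
  ...     | inj₁ k≤l = l , by-coin eq false performs′ ,
         ∑-avg≤ {m} l (≤-trans ∑≤k (fromℕ-mono k l k≤l)) ∑≤l
  ...     | inj₂ l≤k = k , by-coin eq true performs ,
         ∑-avg≤ {m} k ∑≤k (≤-trans ∑≤l (fromℕ-mono l k l≤k))

  -- 7/12 could be any constant strictly between 1/2 and 2/3; 1/6 = 2 · 7/12 − 1.
  family-lowerBound :
    (∃ λ t → + 7 / 12 ≤ haltProb σ G false t []) →
    (∀ i → ∃ λ t → + 7 / 12 ≤ haltProb σ (H i) true t []) →
    ∃ λ k → PerformsFrom σ G [] k × fromℕ m * (+ 1 / 6) ≤ fromℕ k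
  family-lowerBound (t₀ , false-on-G) true-on-H
    with bounded (proj₁ ∘ true-on-H)
  ... | t₁ , ≤t₁ with ∑-hits≤performed (t₀ ℕ.⊔ t₁) []
  ...   | k , performs , ∑≤k = k , performs , (begin
    fromℕ m * (+ 1 / 6)           ≡⟨ ∑-const m (+ 1 / 6) ⟨
    ∑ {m} (λ _ → + 1 / 6)         ≤⟨ ∑-mono 1/6≤hits ⟩
    ∑ (λ i → hits σ G (H i) t []) ≤⟨ ∑≤k ⟩
    fromℕ k                       ∎)
    where
    open ≤-Reasoning
    -- The family is finite, so one time bound serves `G` and all its members at once.
    t = t₀ ℕ.⊔ t₁
    1/6≤hits : ∀ i → + 1 / 6 ≤ hits σ G (H i) t []
    1/6≤hits i = begin
      -- Answering `true` and answering `false` on `G` are disjoint events, so the summand `-1ℚ`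
      -- absorbs `gt + gf` and only `hs` remains.
      -1ℚ + (+ 7 / 12 + + 7 / 12)
        ≤⟨ +-monoʳ-≤ -1ℚ (+-mono-≤ 7/12≤true 7/12≤false) ⟩
      -1ℚ + (haltProb σ (H i) true t [] + gf)
        ≤⟨ +-monoʳ-≤ -1ℚ (+-monoˡ-≤ gf (haltTrue-perturb σ G (H i) t [])) ⟩
      -1ℚ + ((gt + hs) + gf)
        ≡⟨ solve 3 (λ a b c → con -1ℚ :+ ((a :+ b) :+ c) := con -1ℚ :+ (a :+ c) :+ b) refl gt hs gf ⟩
      -1ℚ + (gt + gf) + hs
        ≤⟨ +-monoˡ-≤ hs (+-monoʳ-≤ -1ℚ (haltProb-total≤1 σ G t [])) ⟩
      0ℚ + hs
        ≡⟨ +-identityˡ hs ⟩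
      hs ∎
      where
      open +-*-Solver
      -1ℚ = - 1ℚ
      gt = haltProb σ G true t []
      gf = haltProb σ G false t []
      hs = hits σ G (H i) t []
      7/12≤true : + 7 / 12 ≤ haltProb σ (H i) true t []
      7/12≤true = ≤-trans (proj₂ (true-on-H i))
        (haltProb-mono σ (H i) true [] (ℕₚ.≤-trans (≤t₁ i) (ℕₚ.m≤n⊔m t₀ t₁)))
      7/12≤false : + 7 / 12 ≤ gf
      7/12≤false = ≤-trans false-on-G (haltProb-mono σ G false [] (ℕₚ.m≤m⊔n t₀ t₁))

-- Detecting a self-loop

record AddsLoop {n} (G H : Digraph n) (u : Fin n) : Set where
  field
    keeps : ∀ x y → Edge G x y → Edge H x y
    only  : ∀ x y → Edge H x y → Edge G x y ⊎ (x ≡ u × y ≡ u)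

-- A loop is its own reversal, and `Post G S` is by definition `Pre (flip G) S`. Facts about `Pre`
-- and an added loop therefore carry over to `Post`.
AddsLoop-flip : ∀ {n} {G H : Digraph n} {u} → AddsLoop G H u → AddsLoop (flip G) (flip H) u
AddsLoop-flip G+u = record
  { keeps = λ x y → keeps y x
  ; only  = λ x y e → [ inj₁ , (λ (y≡u , x≡u) → inj₂ (x≡u , y≡u)) ]′ (only y x e)
  }
  where open AddsLoop G+u

module _ {n} {G : Digraph n} where

  -- The loop can add only `u` itself to the predecessors of `S`, and only when `u ∈ S`; an edge of
  -- `G` from `u` into `S` means that `u` is there already.
  Pre-unchanged : ∀ {H u} → AddsLoop G H u → ∀ S →
                  (u ∈ S → ∃ λ s → s ∈ S × Edge G u s) → Pre G S ≡ Pre H S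
  Pre-unchanged {H} {u} G+u S hasSuccessor =
    Vecₚ.tabulate-cong λ v → does-⇔ (mk⇔ (to v) (from v)) (Finₚ.any? _) (Finₚ.any? _)
    where
    open AddsLoop G+u
    to : ∀ v → (∃ λ s → s ∈ S × Edge G v s) → ∃ λ s → s ∈ S × Edge H v s
    to v (s , s∈S , e) = s , s∈S , keeps v s e
    from : ∀ v → (∃ λ s → s ∈ S × Edge H v s) → ∃ λ s → s ∈ S × Edge G v s
    from v (s , s∈S , e) with only v s e
    ... | inj₁ e′            = s , s∈S , e′
    ... | inj₂ (refl , refl) = hasSuccessor s∈S

  -- A query with both u and w in S sees the edge between them, so it already
  -- reports one of u, w as a predecessor, whether or not that one has a loop.
  Pre-separatesOne : ∀ {H H′ u w} → AddsLoop G H u → AddsLoop G H′ w →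
                     Edge G u w ⊎ Edge G w u →
                     ∀ S → Pre G S ≢ Pre H S → Pre G S ≢ Pre H′ S → ⊥
  Pre-separatesOne {u = u} {w} G+u G+w adjacent S u-seen w-seen with u ∈? S | w ∈? S
  ... | no u∉S  | _       = u-seen (Pre-unchanged G+u S (λ u∈S → contradiction u∈S u∉S))
  ... | yes _   | no w∉S  = w-seen (Pre-unchanged G+w S (λ w∈S → contradiction w∈S w∉S))
  ... | yes u∈S | yes w∈S with adjacent
  ...   | inj₁ uw = u-seen (Pre-unchanged G+u S (λ _ → w , w∈S , uw))
  ...   | inj₂ wu = w-seen (Pre-unchanged G+w S (λ _ → u , u∈S , wu))

semicomplete⇒SeparatesOne :
  ∀ {n m} {G : Digraph n} {H : Fin m → Digraph n} (vertex : Fin m → Fin n) →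
  (∀ i → AddsLoop G (H i) (vertex i)) →
  (∀ {i j} → i ≢ j → Edge G (vertex i) (vertex j) ⊎ Edge G (vertex j) (vertex i)) →
  SeparatesOne G H
semicomplete⇒SeparatesOne {G = G} {H} vertex adds semicomplete = record
  { by-Pre = by-Pre ; by-Post = by-Post }
  where
  by-Pre : ∀ S {i j} → Pre G S ≢ Pre (H i) S → Pre G S ≢ Pre (H j) S → i ≡ j
  by-Pre S {i} {j} i-seen j-seen with i Fin.≟ j
  ... | yes i≡j = i≡j
  ... | no i≢j  = contradiction j-seen
    (Pre-separatesOne (adds i) (adds j) (semicomplete i≢j) S i-seen)

  by-Post : ∀ S {i j} → Post G S ≢ Post (H i) S → Post G S ≢ Post (H j) S → i ≡ j
  by-Post S {i} {j} i-seen j-seen with i Fin.≟ j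
  ... | yes i≡j = i≡j
  ... | no i≢j  = contradiction j-seen
    (Pre-separatesOne (AddsLoop-flip (adds i)) (AddsLoop-flip (adds j))
      (swap (semicomplete i≢j)) S i-seen)

withLoop : ∀ {n} → Digraph n → Fin n → Digraph n
withLoop G u x y = G x y ∨ (does (x Fin.≟ u) ∧ does (y Fin.≟ u))

withLoop-addsLoop : ∀ {n} (G : Digraph n) u → AddsLoop G (withLoop G u) u
withLoop-addsLoop G u = record { keeps = keeps ; only = only }
  where
  keeps : ∀ x y → Edge G x y → Edge (withLoop G u) x y
  keeps x y e rewrite e = refl
  only : ∀ x y → Edge (withLoop G u) x y → Edge G x y ⊎ (x ≡ u × y ≡ u)
  only x y e with G x y | x Fin.≟ u | y Fin.≟ u
  ... | true  | _       | _       = inj₁ refl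
  ... | false | yes x≡u | yes y≡u = inj₂ (x≡u , y≡u)
  only x y () | false | yes _ | no _
  only x y () | false | no _  | _

withLoop-loop : ∀ {n} (G : Digraph n) u → Edge (withLoop G u) u u
withLoop-loop G u rewrite dec-true (u Fin.≟ u) refl = ∨-zeroʳ (G u u)

-- The hard inputs

IsHub : {V : Set} → Rel V 0ℓ → V → Set
IsHub R r = ∀ v → R r v × R v r

-- Any two vertices are joined by a two-edge path through the hub, and the pair `u`, `v` attains
-- this bound. The relation is arbitrary so that the argument applies both to the graph and to its
-- induced component.
hub⇒diameter2 : ∀ {V : Set} {R : Rel V 0ℓ} {r u v} → IsHub R r → u ≢ v → ¬ R u v →
                IsDiameter R 2
hub⇒diameter2 {V} {R} {r} {u} {v} hub u≢v ¬Ruv =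
  (u , v , (viaHub u v , refl) , 2≤) , λ x y d (_ , d≤) → d≤ (viaHub x y)
  where
  viaHub : ∀ x y → Star R x y
  viaHub x y = proj₂ (hub x) ◅ proj₁ (hub y) ◅ ε
  2≤ : (p : Star R u v) → 2 ℕ.≤ length p
  2≤ ε             = contradiction refl u≢v
  2≤ (e ◅ ε)       = contradiction e ¬Ruv
  2≤ (_ ◅ _ ◅ _)   = s≤s (s≤s z≤n)

-- The hub makes the graph strongly connected, so `⊤` is the only component and the sum is 2 + 1.
hub⇒SCCDiameterSum≡3 : ∀ {n} {G : Digraph n} {r u v} → IsHub (Edge G) r → u ≢ v → ¬ Edge G u v →
                       IsSCCDiameterSum G 3
hub⇒SCCDiameterSum≡3 {n} {G} {r} {u} {v} hub u≢v ¬uv =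
  ⊤ ∷ [] , 2 ∷ [] , [] ∷ [] , (λ C → mk⇔ to from) , diameter ∷ [] , refl
  where
  connected : ∀ x y → Star (Edge G) x y
  connected x y = proj₂ (hub x) ◅ proj₁ (hub y) ◅ ε
  to : ∀ {C} → C ∈ˡ (⊤ ∷ []) → IsSCC G C
  to (here refl) = r , λ x → mk⇔ (λ _ → connected r x , connected x r) (λ _ → ∈⊤)
  from : ∀ {C} → IsSCC G C → C ∈ˡ (⊤ ∷ [])
  from (x , C-scc) =
    here (⊆-antisym ⊆⊤ λ {y} _ → Equivalence.from (C-scc y) (connected x y , connected y x))
  diameter : IsDiameter (Induced G ⊤) 2
  diameter = hub⇒diameter2 {r = r , ∈⊤} {u , ∈⊤} {v , ∈⊤} (hub ∘ proj₁) (u≢v ∘ cong proj₁) ¬uv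

-- The hub also has a self-loop, as `IsHub` requires; it does no harm, since the hub will be unsafe.
hubbedTournament : ∀ m → Digraph (suc m)
hubbedTournament m zero    _       = true
hubbedTournament m (suc _) zero    = true
hubbedTournament m (suc i) (suc j) = does (i Finₚ.<? j)

module _ {m : ℕ} where
  private G = hubbedTournament m

  <⇒edge : ∀ {i j : Fin m} → i Fin.< j → Edge G (suc i) (suc j)
  <⇒edge {i} {j} = dec-true (i Finₚ.<? j)

  edge⇒< : ∀ {i j : Fin m} → Edge G (suc i) (suc j) → i Fin.< j
  edge⇒< {i} {j} e = invert (subst (Reflects (i Fin.< j)) e (proof (i Finₚ.<? j)))

  tournament-semicomplete : ∀ {i j : Fin m} → i ≢ j →
                            Edge G (suc i) (suc j) ⊎ Edge G (suc j) (suc i)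
  tournament-semicomplete {i} {j} i≢j with Finₚ.<-cmp i j
  ... | tri< i<j _ _ = inj₁ (<⇒edge i<j)
  ... | tri≈ _ i≡j _ = contradiction i≡j i≢j
  ... | tri> _ _ j<i = inj₂ (<⇒edge j<i)

  tournament-hub : IsHub (Edge G) zero
  tournament-hub zero    = refl , refl
  tournament-hub (suc _) = refl , refl

-- The offset 3 provides the hub and two tournament vertices, whose missing backward edge forces
-- diameter 2. The start is the first tournament vertex, one edge away from every other one.
input : ∀ m → Digraph (3 ℕ.+ m) → Input
input m G = record { n = 3 ℕ.+ m ; graph = G ; start = suc zero ; safe = outside ∷ ⊤ }

module _ (m : ℕ) where

  unlooped : Digraph (3 ℕ.+ m)
  unlooped = hubbedTournament (2 ℕ.+ m)

  looped : Fin (2 ℕ.+ m) → Digraph (3 ℕ.+ m)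
  looped i = withLoop unlooped (suc i)

  looped-addsLoop : ∀ i → AddsLoop unlooped (looped i) (suc i)
  looped-addsLoop i = withLoop-addsLoop unlooped (suc i)

  unlooped-diameter : DiameterAtMost 2 (input m unlooped)
  unlooped-diameter =
    2 , hub⇒diameter2 {u = suc (suc zero)} {suc zero} tournament-hub (λ ()) (λ ()) , ℕₚ.≤-refl

  looped-diameter : ∀ i → DiameterAtMost 2 (input m (looped i))
  looped-diameter i =
    2 , hub⇒diameter2 {u = suc (suc zero)} {suc zero} hub (λ ()) ¬edge , ℕₚ.≤-refl
    where
    open AddsLoop (looped-addsLoop i)
    hub : IsHub (Edge (looped i)) zero
    hub v = keeps zero v (proj₁ (tournament-hub v)) , keeps v zero (proj₂ (tournament-hub v))
    ¬edge : ¬ Edge (looped i) (suc (suc zero)) (suc zero)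
    ¬edge e with only (suc (suc zero)) (suc zero) e
    ... | inj₁ ()
    ... | inj₂ (2≡ , 1≡) = contradiction (trans 2≡ (sym 1≡)) λ ()

  unlooped-SCCDiameterSum : IsSCCDiameterSum unlooped 3
  unlooped-SCCDiameterSum =
    hub⇒SCCDiameterSum≡3 {u = suc (suc zero)} {suc zero} tournament-hub (λ ()) (λ ())

  unlooped-¬CoBüchi : ¬ CoBüchi (input m unlooped)
  unlooped-¬CoBüchi (p , (_ , path) , k , safe-after) =
    -- From time `k` on the path avoids the hub, so each step raises the index; `3 + m` further
    -- steps would force an index of at least the number of vertices.
    ℕₚ.<-irrefl refl (ℕₚ.≤-<-trans (climbs (3 ℕ.+ m)) (Finₚ.toℕ<n (p (3 ℕ.+ m ℕ.+ k))))
    where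
    increasing : ∀ {x y} → x ∈ safe (input m unlooped) → y ∈ safe (input m unlooped) →
                 Edge unlooped x y → toℕ x ℕ.< toℕ y
    increasing {suc i} {suc j} _ _ e = s≤s (edge⇒< e)
    climbs : ∀ i → i ℕ.≤ toℕ (p (i ℕ.+ k))
    climbs zero    = z≤n
    climbs (suc i) = ℕₚ.≤-<-trans (climbs i)
      (increasing (safe-after (i ℕ.+ k) (ℕₚ.m≤n+m k i))
        (safe-after (suc i ℕ.+ k) (ℕₚ.m≤n+m k (suc i))) (path (i ℕ.+ k)))

  looped-Safe : ∀ i → Safe (input m (looped i))
  looped-Safe i = p , (refl , path) , stays-safe
    where
    open AddsLoop (looped-addsLoop i)
    p : ℕ → Fin (3 ℕ.+ m)
    p zero    = suc zero
    p (suc _) = suc i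
    loop : Edge (looped i) (suc i) (suc i)
    loop = withLoop-loop unlooped (suc i)
    path : ∀ t → Edge (looped i) (p t) (p (suc t))
    path (suc _) = loop
    -- The start may be the looped vertex itself; then the first step already uses the loop.
    path zero with i Fin.≟ zero
    ... | yes i≡0 = subst (λ j → Edge (looped i) (suc j) (suc i)) i≡0 loop
    ... | no i≢0  = keeps (suc zero) (suc i) (<⇒edge (ℕₚ.n≢0⇒n>0 (i≢0 ∘ Finₚ.toℕ-injective)))
    stays-safe : ∀ t → p t ∈ safe (input m (looped i))
    stays-safe zero    = there ∈⊤
    stays-safe (suc _) = there ∈⊤

  -- Lower bounds for both objectives

  7/12<2/3 : + 7 / 12 < + 2 / 3
  7/12<2/3 = from-yes (+ 7 / 12 <? + 2 / 3)

  -- All problems between `Safe` and `CoBüchi` have the same answers on the hard inputs: without a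
  -- loop even `CoBüchi` fails, and with one even `Safe` holds. One argument thus covers both
  -- objectives.
  hard-family : ∀ P → (∀ I → Safe I → P I) → (∀ I → P I → CoBüchi I) →
                ∀ A → SolvesUpToDiameter 2 P A →
                ∃ λ k → Performs A (input m unlooped) k × fromℕ (2 ℕ.+ m) * (+ 1 / 6) ≤ fromℕ k
  hard-family P Safe⇒P P⇒CoBüchi A solves = family-lowerBound σ separatesOne false-on-G true-on-H
    where
    σ : Strategy (3 ℕ.+ m)
    σ = A (3 ℕ.+ m) (suc zero) (outside ∷ ⊤)
    separatesOne : SeparatesOne unlooped looped
    separatesOne = semicomplete⇒SeparatesOne suc looped-addsLoop tournament-semicomplete
    false-on-G : ∃ λ t → + 7 / 12 ≤ haltProb σ unlooped false t []
    false-on-G = proj₂ (solves (input m unlooped) unlooped-diameter)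
                   (unlooped-¬CoBüchi ∘ P⇒CoBüchi _) (+ 7 / 12) 7/12<2/3
    true-on-H : ∀ i → ∃ λ t → + 7 / 12 ≤ haltProb σ (looped i) true t []
    true-on-H i = proj₁ (solves (input m (looped i)) (looped-diameter i))
                    (Safe⇒P _ (looped-Safe i)) (+ 7 / 12) 7/12<2/3

  lowerBound : ∀ P → (∀ I → Safe I → P I) → (∀ I → P I → CoBüchi I) →
               ∀ A → SolvesUpToDiameter 2 P A →
               ∃ λ k → Performs A (input m unlooped) k × (+ 1 / 12) * fromℕ (3 ℕ.+ m) ≤ fromℕ k
  lowerBound P Safe⇒P P⇒CoBüchi A solves =
    let k , performs , bound = hard-family P Safe⇒P P⇒CoBüchi A solves
    in k , performs , rescale (fromℕ (3 ℕ.+ m)) (fromℕ M) (fromℕ k) n≤2M bound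
    where
    M = 2 ℕ.+ m
    n≤2M : fromℕ (3 ℕ.+ m) ≤ fromℕ M + fromℕ M
    n≤2M = ≤-trans (fromℕ-mono (3 ℕ.+ m) (M ℕ.+ M) (s≤s (ℕₚ.m≤n+m M (suc m))))
                   (≤-reflexive (fromℕ-+ M M))

∣safe∣≡ : ∀ m G → ∣ safe (input m G) ∣ ≡ 2 ℕ.+ m
∣safe∣≡ m G = ∣⊤∣≡n (2 ℕ.+ m)

∣safe∣≤ : ∀ m G → ∣ safe (input m G) ∣ ℕ.≤ 3 ℕ.+ m
∣safe∣≤ m G = ℕₚ.≤-trans (ℕₚ.≤-reflexive (∣safe∣≡ m G)) (ℕₚ.n≤1+n (2 ℕ.+ m))

lowerBounds : ∀ P → (∀ I → Safe I → P I) → (∀ I → P I → CoBüchi I) →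
  Ω-ConstDiameter P n
  × Ω-ConstDiameter P (λ I → ∣ safe I ∣)
  × ω-ConstDiameter P (λ I m → IsSCCDiameterSum (graph I) m)
lowerBounds P Safe⇒P P⇒CoBüchi = inVertices , inSafeVertices , inSCCDiameters
  where
  0<1/12 : 0ℚ < + 1 / 12
  0<1/12 = from-yes (0ℚ <? + 1 / 12)

  inVertices : Ω-ConstDiameter P n
  inVertices = 2 , + 1 / 12 , 0<1/12 , λ A solves N →
    let k , performs , bound = lowerBound N P Safe⇒P P⇒CoBüchi A solves
    in input N (unlooped N) , k , unlooped-diameter N , ℕₚ.m≤n+m N 3 , performs , bound

  inSafeVertices : Ω-ConstDiameter P (λ I → ∣ safe I ∣)
  inSafeVertices = 2 , + 1 / 12 , 0<1/12 , λ A solves N →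
    let k , performs , bound = lowerBound N P Safe⇒P P⇒CoBüchi A solves
    in input N (unlooped N) , k , unlooped-diameter N ,
       ℕₚ.≤-trans (ℕₚ.m≤n+m N 2) (ℕₚ.≤-reflexive (sym (∣safe∣≡ N (unlooped N)))) , performs ,
       scale-mono ∣ safe (input N (unlooped N)) ∣ (3 ℕ.+ N) k (∣safe∣≤ N (unlooped N)) bound

  inSCCDiameters : ω-ConstDiameter P (λ I m → IsSCCDiameterSum (graph I) m)
  inSCCDiameters = 2 , λ K _ A solves →
    -- The component sum stays 3 while at least `N / 12` operations are performed, so `N > 36 K`
    -- gives more than `3 K` of them.
    let N , 36K<N = archimedean (fromℕ 36 * K)
        k , performs , bound = lowerBound N P Safe⇒P P⇒CoBüchi A solves
    in input N (unlooped N) , 3 , k , unlooped-diameter N , unlooped-SCCDiameterSum N , performs ,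
       scale-< K (fromℕ N) (fromℕ k) 36K<N (scale-mono N (3 ℕ.+ N) k (ℕₚ.m≤n+m N 3) bound)

theorem3p11 : ( Ω-ConstDiameter Safe (λ I → n I)
    × Ω-ConstDiameter Safe (λ I → ∣ safe I ∣)
    × ω-ConstDiameter Safe (λ I m → IsSCCDiameterSum (graph I) m) )
    ×
    ( Ω-ConstDiameter CoBüchi (λ I → n I)
    × Ω-ConstDiameter CoBüchi (λ I → ∣ safe I ∣)
    × ω-ConstDiameter CoBüchi (λ I m → IsSCCDiameterSum (graph I) m) )
theorem3p11 = lowerBounds Safe (λ I x → x) Safe⇒CoBüchi ,
              lowerBounds CoBüchi Safe⇒CoBüchi (λ I x → x)
  where
  Safe⇒CoBüchi : ∀ I → Safe I → CoBüchi I
  Safe⇒CoBüchi I (p , path , p-safe) = p , path , 0 , λ i _ → p-safe i
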